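{- Let $n$ be a positive integer and let $\theta=\lambda/\mu$ be a skew Young diagram such that every column of $\theta$ contains at most $n$ boxes. Then the number $|\mathrm{SVT}(\theta,n)|$ of set-valued tableaux of shape $\theta$ with entries in $[n]=\{1,\dots,n\}$ is odd.
   Context: A partition $\lambda=(\lambda_1\ge\lambda_2\ge\cdots\ge 0)$ is identified with its Young diagram $\{(i,j)\in\mathbb{Z}_{>0}^2 : j\le\lambda_i\}$ (row index $i$ increasing downward, column index $j$ increasing to the right). For partitions $\mu\subseteq\lambda$, the skew Young diagram $\theta=\lambda/\mu$ is the set-theoretic difference $\lambda\setminus\mu$, and $|\theta|$ is its number of boxes. A set-valued tableau of shape $\theta$ with entries in $[n]$ is an assignment of a non-empty subset $T_{i,j}\subseteq[n]$ to each box $(i,j)\in\theta$ such that $\max T_{i,j}\le\min T_{i,j+1}$ whenever $(i,j),(i,j+1)\in\theta$, and $\max T_{i,j}<\min T_{i+1,j}$ whenever $(i,j),(i+1,j)\in\theta$. $\mathrm{SVT}(\theta,n)$ denotes the set of all such tableaux. -}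

module Defs where

open import Data.Bool.Base using (true; false)
open import Data.Fin.Base as Fin using (Fin; zero; suc)
open import Data.Fin.Subset using (Subset; Nonempty; _∈_)
open import Data.Fin.Subset.Properties using (nonempty?; drop-there)
open import Data.List.Base using (length; filter; upTo)
open import Data.Nat.Base using (ℕ; zero; suc; _≤_; _<_; z≤n; s≤s)
open import Data.Nat.Properties using (_<?_)
open import Data.Product.Base using (_×_; _,_)
open import Data.Vec.Base using (_∷_; here; there)
open import Function.Bundles using (Inverse)
open import Level using (Level; 0ℓ; _⊔_)
open import Relation.Binary.Bundles using (Setoid)
open import Relation.Binary.PropositionalEquality
  using (_≡_; refl; sym; trans; setoid)
open import Relation.Nullary.Decidable using (Dec; yes; no; ¬?; _×-dec_)
open import Relation.Nullary.Negation using (¬_; contradiction)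

private
  variable
    n : ℕ
    a ℓ : Level

-- Rows and columns are numbered from 0, so `part λ′ i` is the (i+1)-st part
-- of the partition.  `bound` is any index from which all parts vanish; it need
-- not be the exact number of non-zero parts.
record Partition : Set where
  field
    part       : ℕ → ℕ
    decreasing : ∀ i → part (suc i) ≤ part i
    bound      : ℕ
    vanishing  : ∀ i → bound ≤ i → part i ≡ 0

open Partition public

InDiagram : Partition → ℕ → ℕ → Set
InDiagram λ′ i j = j < part λ′ i

record SkewDiagram : Set where
  field
    outer     : Partition
    inner     : Partition
    contained : ∀ {i j} → InDiagram inner i j → InDiagram outer i j

open SkewDiagram public

InSkew : SkewDiagram → ℕ → ℕ → Set
InSkew θ i j = InDiagram (outer θ) i j × ¬ InDiagram (inner θ) i j

inSkew? : ∀ θ i j → Dec (InSkew θ i j)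
inSkew? θ i j = (j <? part (outer θ) i) ×-dec ¬? (j <? part (inner θ) i)

-- Every box of θ lies in a row below `bound (outer θ)`, so restricting the
-- count to those rows loses nothing.
columnSize : SkewDiagram → ℕ → ℕ
columnSize θ j = length (filter (λ i → inSkew? θ i j) (upTo (bound (outer θ))))

-- The set [n] = {1,…,n} is modelled by the n-element chain Fin n.

minimum : (p : Subset n) → Nonempty p → Fin n
minimum (true  ∷ p) _                     = zero
minimum (false ∷ p) (suc x , there x∈p) = suc (minimum p (x , x∈p))

maximum : (p : Subset n) → Nonempty p → Fin n
maximum (s ∷ p) _ with nonempty? p
... | yes ne = suc (maximum p ne)
... | no  _  = zero

minimum-∈ : (p : Subset n) (ne : Nonempty p) → minimum p ne ∈ p
minimum-∈ (true  ∷ p) _                     = here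
minimum-∈ (false ∷ p) (suc x , there x∈p) = there (minimum-∈ p (x , x∈p))

minimum-≤ : (p : Subset n) (ne : Nonempty p) →
            ∀ {y} → y ∈ p → minimum p ne Fin.≤ y
minimum-≤ (true  ∷ p) _                   _           = z≤n
minimum-≤ (false ∷ p) (suc x , there x∈p) (there y∈p) =
  s≤s (minimum-≤ p (x , x∈p) y∈p)

maximum-∈ : (p : Subset n) (ne : Nonempty p) → maximum p ne ∈ p
maximum-∈ (s ∷ p) ne with nonempty? p
maximum-∈ (s ∷ p) _                   | yes ne = there (maximum-∈ p ne)
maximum-∈ (_ ∷ p) (zero  , here)      | no  _  = here
maximum-∈ (_ ∷ p) (suc x , there x∈p) | no ¬ne = contradiction (x , x∈p) ¬ne

maximum-≥ : (p : Subset n) (ne : Nonempty p) →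
            ∀ {y} → y ∈ p → y Fin.≤ maximum p ne
maximum-≥ (s ∷ p) _ {y} y∈ with nonempty? p
maximum-≥ (s ∷ p) _ {zero}  _  | yes ne = z≤n
maximum-≥ (s ∷ p) _ {suc y} y∈ | yes ne = s≤s (maximum-≥ p ne (drop-there y∈))
maximum-≥ (s ∷ p) _ {zero}  _  | no  _  = z≤n
maximum-≥ (s ∷ p) _ {suc y} y∈ | no ¬ne = contradiction (y , drop-there y∈) ¬ne

-- Membership proofs are taken irrelevantly, so that an entry depends only on
-- the box and not on the proof that the box lies in θ.
record SVT (θ : SkewDiagram) (n : ℕ) : Set where
  field
    entry    : ∀ i j → .(InSkew θ i j) → Subset n
    nonempty : ∀ i j .(b : InSkew θ i j) → Nonempty (entry i j b)
    row-weak : ∀ i j .(b : InSkew θ i j) .(b′ : InSkew θ i (suc j)) →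
               maximum (entry i j b) (nonempty i j b)
                 Fin.≤ minimum (entry i (suc j) b′) (nonempty i (suc j) b′)
    column-strict :
               ∀ i j .(b : InSkew θ i j) .(b′ : InSkew θ (suc i) j) →
               maximum (entry i j b) (nonempty i j b)
                 Fin.< minimum (entry (suc i) j b′) (nonempty (suc i) j b′)

open SVT public

-- Two tableaux are the same when their entries agree box by box; propositional
-- equality of the records would be too fine without function extensionality.
SVT-setoid : SkewDiagram → ℕ → Setoid 0ℓ 0ℓ
SVT-setoid θ n = record
  { Carrier       = SVT θ n
  ; _≈_           = λ S T → ∀ i j .(b : InSkew θ i j) → entry S i j b ≡ entry T i j b
  ; isEquivalence = record
    { refl  = λ i j b → refl
    ; sym   = λ S≈T i j b → sym (S≈T i j b)
    ; trans = λ S≈T T≈U i j b → trans (S≈T i j b) (T≈U i j b)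
    }
  }

HasCardinality : Setoid a ℓ → ℕ → Set (a ⊔ ℓ)
HasCardinality S N = Inverse (setoid (Fin N)) S

{-# OPTIONS --safe #-}
-- Let d(i,j) be the number of boxes of θ above (i,j) in its column.  Filling each
-- box with {d(i,j)} is a tableau, and by column strictness every entry of every
-- tableau is bounded below by d.  In an arbitrary tableau call a box off if its
-- entry contains something other than d(i,j).  At each off box whose left and upper
-- neighbours are not off, add d(i,j) to the entry or remove it.  The entry stays
-- non-empty with the same maximum, its left and upper neighbours are {d}, and the
-- set of off boxes does not change; so this is an involution on tableaux, and its
-- only fixed point is the filling by {d}.
module Submission where

open import Defs
import Algebra.Properties.CommutativeMonoid.Sum as Sum
open import Data.Bool.Base using (Bool; true; false; _xor_; if_then_else_)
import Data.Bool.Properties as Bool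
open import Data.Empty using (⊥; ⊥-elim-irr)
open import Data.Fin.Base as Fin using (Fin; zero; suc; toℕ; fromℕ<; finToFun; funToFin)
import Data.Fin.Permutation as Perm
import Data.Fin.Properties as Fin
open import Data.Fin.Subset using (_∈_)
open import Data.List.Base
  using (List; []; _∷_; _++_; filter; length; upTo; allFin; map; lookup)
open import Data.List.Properties using (upTo-∷ʳ; filter-++; length-++; filter-accept)
open import Data.List.Membership.Propositional.Properties using (∈-allFin)
import Data.List.Membership.Setoid.Properties as Membership
open import Data.List.Relation.Unary.All as All using (All)
open import Data.List.Relation.Unary.Any using (index)
open import Data.List.Relation.Unary.AllPairs using (_∷_)
open import Data.List.Relation.Unary.Enumerates.Setoid using (IsEnumeration)
import Data.List.Relation.Unary.Enumerates.Setoid.Properties as Enumerates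
open import Data.List.Relation.Unary.Any.Properties using (lookup-index)
import Data.List.Relation.Unary.Unique.Setoid as UniqueSetoid
open import Data.List.Relation.Unary.Unique.DecSetoid.Properties using (deduplicate-!)
open import Data.Nat.Base
  using (ℕ; zero; suc; NonZero; _+_; _^_; _≤_; _<_; _≤′_; ≤′-refl; ≤′-step; z≤n; s≤s)
open import Data.Nat.Divisibility using (_∤_; ∣m+n∣m⇒∣n; divides; ∣1⇒≡1)
open import Data.Nat.DivMod using (_mod_; m<n⇒m%n≡m)
import Data.Nat.Properties as ℕ
open import Data.Product using (_×_; ∃-syntax; _,_; proj₁; proj₂)
open import Data.Sum.Base using (_⊎_; inj₁; inj₂)
import Data.Vec.Base as Vec
import Data.Vec.Properties as Vec
open import Function.Base using (_∘_)
open import Function.Bundles using (Inverse; _⇔_; mk⇔; Equivalence)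
open import Level using (Level)
open import Relation.Binary.Bundles using (Setoid; DecSetoid)
open import Relation.Binary.Core using (Rel)
open import Relation.Binary.Definitions using (tri<; tri≈; tri>) renaming (Decidable to Decidable₂)
open import Relation.Binary.PropositionalEquality
  using (_≡_; _≢_; refl; sym; trans; cong; cong₂; subst; subst₂; setoid; module ≡-Reasoning)
open import Relation.Nullary.Decidable
  using (Dec; yes; no; does; ¬?; _×-dec_; _→-dec_; map′; dec-true; dec-false; does-⇔; recompute)
open import Relation.Nullary.Negation using (¬_; contradiction)

private
  variable
    a ℓ : Level
    m n N : ℕ

open Sum ℕ.+-0-commutativeMonoid
  using (sum; sum-cong-≗; ∑-distrib-+; sum-permute; sum-replicate-zero)

-- Parity of a finite set with an involution fixing exactly one point.

indicator : {P : Set ℓ} → Dec P → ℕ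
indicator P? = if does P? then 1 else 0

sum-const-1 : ∀ n → sum {n} (λ _ → 1) ≡ n
sum-const-1 zero    = refl
sum-const-1 (suc n) = cong suc (sum-const-1 n)

sum-indicator-≡ : (c : Fin n) → sum (λ i → indicator (i Fin.≟ c)) ≡ 1
sum-indicator-≡ {suc n} zero    = cong suc (sum-replicate-zero n)
sum-indicator-≡ {suc n} (suc c) = sum-indicator-≡ c

2∤m+m+1 : ∀ m → 2 ∤ (m + m + 1)
2∤m+m+1 m 2∣ = contradiction (∣1⇒≡1 (∣m+n∣m⇒∣n 2∣ (divides m m+m≡m*2))) λ ()
  where
  m+m≡m*2 = trans (cong (m +_) (sym (ℕ.+-identityʳ m))) (ℕ.*-comm 2 m)

-- The non-fixed points split into ascents i < f i and descents f i < i, which f exchanges.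
involution-unique-fixed-point⇒odd : (f : Fin N → Fin N) → (∀ i → f (f i) ≡ i) →
  (c : Fin N) → f c ≡ c → (∀ i → f i ≡ i → i ≡ c) → 2 ∤ N
involution-unique-fixed-point⇒odd {N} f f∘f c fc≡c unique =
  subst (2 ∤_) (sym N≡) (2∤m+m+1 (sum ascent))
  where
  ascent descent fixed : Fin N → ℕ
  ascent  i = indicator (i Fin.<? f i)
  descent i = indicator (f i Fin.<? i)
  fixed   i = indicator (i Fin.≟ c)

  split : ∀ i → ascent i + descent i + fixed i ≡ 1
  split i with Fin.<-cmp i (f i)
  ... | tri< i<fi i≢fi i≯fi
    rewrite dec-true (i Fin.<? f i) i<fi | dec-false (f i Fin.<? i) i≯fi
          | dec-false (i Fin.≟ c) (λ { refl → i≢fi (sym fc≡c) }) = refl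
  ... | tri≈ i≮fi i≡fi i≯fi
    rewrite dec-false (i Fin.<? f i) i≮fi | dec-false (f i Fin.<? i) i≯fi
          | dec-true (i Fin.≟ c) (unique i (sym i≡fi)) = refl
  ... | tri> i≮fi i≢fi i>fi
    rewrite dec-false (i Fin.<? f i) i≮fi | dec-true (f i Fin.<? i) i>fi
          | dec-false (i Fin.≟ c) (λ { refl → i≢fi (sym fc≡c) }) = refl

  descents≡ascents : sum descent ≡ sum ascent
  descents≡ascents = trans
    (sum-permute descent (Perm.permutation f f f∘f f∘f))
    (sum-cong-≗ (λ i → cong (λ k → indicator (k Fin.<? f i)) (f∘f i)))

  open ≡-Reasoning

  N≡ : N ≡ sum ascent + sum ascent + 1
  N≡ = begin
    N                                             ≡⟨ sum-const-1 N ⟨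
    sum {N} (λ _ → 1)                             ≡⟨ sum-cong-≗ split ⟨
    sum (λ i → ascent i + descent i + fixed i)    ≡⟨ ∑-distrib-+ _ fixed ⟩
    sum (λ i → ascent i + descent i) + sum fixed  ≡⟨ cong₂ _+_ (∑-distrib-+ ascent descent)
                                                                (sum-indicator-≡ c) ⟩
    sum ascent + sum descent + 1                  ≡⟨ cong (λ k → sum ascent + k + 1) descents≡ascents ⟩
    sum ascent + sum ascent + 1                   ∎

-- Cardinalities of setoids.

module _ (S : Setoid a ℓ) where
  open Setoid S renaming (Carrier to A; refl to ≈-refl; sym to ≈-sym; trans to ≈-trans)
  open UniqueSetoid S using (Unique)

  -- Conjugation by the bijection turns `φ` into an involution of `Fin N`; `φ-cong` lets the inner
  -- `to ∘ from` cancel.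
  involution⇒odd-cardinality : (φ : A → A) → (∀ {x y} → x ≈ y → φ x ≈ φ y) →
    (∀ x → φ (φ x) ≈ x) → (c : A) → φ c ≈ c → (∀ x → φ x ≈ x → x ≈ c) →
    HasCardinality S N → 2 ∤ N
  involution⇒odd-cardinality φ φ-cong φ∘φ c φc≈c unique inv =
    involution-unique-fixed-point⇒odd f f∘f (from c) fixed unique′
    where
    open Inverse inv
    f : Fin _ → Fin _
    f = from ∘ φ ∘ to
    f∘f : ∀ i → f (f i) ≡ i
    f∘f i = inverseʳ (≈-trans (φ-cong (inverseˡ refl)) (φ∘φ (to i)))
    fixed : f (from c) ≡ from c
    fixed = from-cong (≈-trans (φ-cong (inverseˡ refl)) φc≈c)
    unique′ : ∀ i → f i ≡ i → i ≡ from c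
    unique′ i fi≡i = sym (inverseʳ (≈-sym (unique (to i)
      (≈-sym (≈-trans (to-cong (sym fi≡i)) (inverseˡ refl))))))

  lookup-≉ : ∀ {x xs} → All (λ y → ¬ (x ≈ y)) xs → ∀ i → ¬ (x ≈ lookup xs i)
  lookup-≉ {xs = xs} x≉ i =
    All.lookupₛ S (λ u≈v x≉u x≈v → x≉u (≈-trans x≈v (≈-sym u≈v))) x≉ (Membership.∈-lookup S xs i)

  lookup-injective : ∀ {xs} → Unique xs → ∀ i j → lookup xs i ≈ lookup xs j → i ≡ j
  lookup-injective (x≉ ∷ !xs) zero    zero    _  = refl
  lookup-injective (x≉ ∷ !xs) (suc i) (suc j) eq = cong suc (lookup-injective !xs i j eq)
  lookup-injective (x≉ ∷ !xs) zero    (suc j) eq = contradiction eq (lookup-≉ x≉ j)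
  lookup-injective (x≉ ∷ !xs) (suc i) zero    eq = contradiction (≈-sym eq) (lookup-≉ x≉ i)

  -- The inverse of `lookup` returns the index at which `x` is found; uniqueness makes that index
  -- depend only on the class of `x`.
  enumeration⇒cardinality : ∀ {xs} → Unique xs → IsEnumeration S xs → HasCardinality S (length xs)
  enumeration⇒cardinality {xs} !xs _∈xs = record
    { to        = lookup xs
    ; from      = position
    ; to-cong   = λ { refl → ≈-refl }
    ; from-cong = λ {x} {y} x≈y → lookup-injective !xs _ _
                    (≈-trans (≈-sym (at x)) (≈-trans x≈y (at y)))
    ; inverse   = (λ { {x} refl → ≈-sym (at x) })
                , (λ {i} {y} y≈ → lookup-injective !xs _ _ (≈-trans (≈-sym (at y)) y≈))
    }
    where
    position : A → Fin (length xs)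
    position x = index (x ∈xs)
    at : ∀ x → x ≈ lookup xs (position x)
    at x = lookup-index (x ∈xs)

module _ (S : DecSetoid a ℓ) where
  open DecSetoid S using (Carrier; _≈_) renaming (setoid to S′)

  -- `decode` may repeat values: decidability of `≈` allows duplicates to be dropped from the list
  -- of its values.
  finite⇒cardinality : (decode : Fin m → Carrier) →
    (∀ x → ∃[ c ] decode c ≈ x) → ∃[ N ] HasCardinality S′ N
  finite⇒cardinality {m} decode surjective =
    _ , enumeration⇒cardinality S′ (deduplicate-! S decoded) (Enumerates.deduplicate⁺ S enumerates)
    where
    decoded : List Carrier
    decoded = map decode (allFin m)
    enumerates : IsEnumeration S′ decoded
    enumerates x with c , dc≈x ← surjective x = Membership.∈-resp-≈ S′ dc≈x
      (Membership.∈-map⁺ (setoid (Fin m)) S′ (λ { refl → DecSetoid.refl S }) (∈-allFin c))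

-- Diagram geometry

module _ (θ : SkewDiagram) where

  part-≤-first : (p : Partition) → ∀ i → part p i ≤ part p 0
  part-≤-first p zero    = ℕ.≤-refl
  part-≤-first p (suc i) = ℕ.≤-trans (decreasing p i) (part-≤-first p i)

  row<bound : ∀ {i j} → InSkew θ i j → i < bound (outer θ)
  row<bound {i} (j<λ , _) = ℕ.≰⇒> λ b≤i →
    contradiction (subst (_ <_) (vanishing (outer θ) i b≤i) j<λ) λ ()

  column<width : ∀ {i j} → InSkew θ i j → j < part (outer θ) 0
  column<width {i} (j<λ , _) = ℕ.<-≤-trans j<λ (part-≤-first (outer θ) i)

  -- The corner is in the outer diagram because the box below it is, and outside the inner one
  -- because its left neighbour is.
  inSkew-corner : ∀ {i j} → InSkew θ i j → InSkew θ (suc i) (suc j) → InSkew θ i (suc j)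
  inSkew-corner {i} (_ , j≮μ) (j′<λ , _) =
    ℕ.<-≤-trans j′<λ (decreasing (outer θ) i) , λ j′<μ → j≮μ (ℕ.<-trans (ℕ.n<1+n _) j′<μ)

  -- All boxes lie in a rectangle of `bound (outer θ)` rows and `part (outer θ) 0` columns, so a
  -- finite search decides.
  allBoxes? : ∀ {p} {P : ℕ → ℕ → Set p} → (∀ i j → Dec (P i j)) → Dec (∀ i j → InSkew θ i j → P i j)
  allBoxes? P? = map′
    (λ all i j b → all (row<bound b) (column<width b) b)
    (λ all {i} _ {j} _ b → all i j b)
    (ℕ.allUpTo? (λ i → ℕ.allUpTo? (λ j → inSkew? θ i j →-dec P? i j) (part (outer θ) 0))
      (bound (outer θ)))

  -- The number of boxes of θ above (i , j) in its column, when (i , j) is a box.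
  depth : ℕ → ℕ → ℕ
  depth zero    j = 0
  depth (suc i) j = if does (inSkew? θ i j) then suc (depth i j) else 0

  depth-suc : ∀ {i j} → InSkew θ i j → depth (suc i) j ≡ suc (depth i j)
  depth-suc {i} {j} b rewrite dec-true (inSkew? θ i j) b = refl

  depth-suc-outside : ∀ {i j} → ¬ InSkew θ i j → depth (suc i) j ≡ 0
  depth-suc-outside {i} {j} ¬b rewrite dec-false (inSkew? θ i j) ¬b = refl

  -- Going up column `j` from row `i`, each box has a right neighbour by `inSkew-corner`, and that
  -- neighbour is the lower right box for the next step. This gives the row condition for the
  -- filling by depths.
  depth-mono : ∀ i j → InSkew θ i (suc j) → depth i j ≤ depth i (suc j)
  depth-mono zero    j b′ = z≤n
  depth-mono (suc i) j b′ with inSkew? θ i j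
  ... | no ¬b rewrite depth-suc-outside ¬b = z≤n
  ... | yes b rewrite depth-suc b | depth-suc (inSkew-corner b b′) =
    s≤s (depth-mono i j (inSkew-corner b b′))

  private
    -- At `i = bound (outer θ)` this is `columnSize θ j` by definition; the free `i` allows
    -- induction on rows.
    above : ℕ → ℕ → ℕ
    above j i = length (filter (λ k → inSkew? θ k j) (upTo i))

  above-suc : ∀ j i → above j (suc i) ≡ above j i + length (filter (λ k → inSkew? θ k j) (i ∷ []))
  above-suc j i = begin
    above j (suc i)                              ≡⟨ cong (length ∘ filter P?) (upTo-∷ʳ i) ⟨
    length (filter P? (upTo i ++ i ∷ []))        ≡⟨ cong length (filter-++ P? (upTo i) (i ∷ [])) ⟩
    length (filter P? (upTo i) ++ filter P? (i ∷ []))  ≡⟨ length-++ (filter P? (upTo i)) ⟩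
    above j i + length (filter P? (i ∷ [])) ∎
    where
    open ≡-Reasoning
    P? = λ k → inSkew? θ k j

  above-step : ∀ {i j} → InSkew θ i j → above j (suc i) ≡ suc (above j i)
  above-step {i} {j} b = trans (above-suc j i)
    (trans (cong (λ xs → above j i + length xs) (filter-accept (λ k → inSkew? θ k j) b)) (ℕ.+-comm _ 1))

  above-mono : ∀ j {i i′} → i ≤′ i′ → above j i ≤ above j i′
  above-mono j ≤′-refl = ℕ.≤-refl
  above-mono j (≤′-step {i′} i≤i′) = ℕ.≤-trans (above-mono j i≤i′)
    (subst (above j i′ ≤_) (sym (above-suc j i′)) (ℕ.m≤m+n _ _))

  -- Both grow by one at a box; elsewhere `depth` falls back to 0, whence only an inequality.
  depth≤above : ∀ i j → depth i j ≤ above j i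
  depth≤above zero    j = z≤n
  depth≤above (suc i) j with inSkew? θ i j
  ... | no ¬b rewrite depth-suc-outside ¬b = z≤n
  ... | yes b rewrite depth-suc b | above-step b = s≤s (depth≤above i j)

  -- Strict because the column also contains the box itself, which `depth` does not count.
  depth<columnSize : ∀ {i j} → InSkew θ i j → depth i j < columnSize θ j
  depth<columnSize {i} {j} b = ℕ.≤-trans (s≤s (depth≤above i j))
    (ℕ.≤-trans (ℕ.≤-reflexive (sym (above-step b))) (above-mono j (ℕ.≤⇒≤′ (row<bound b))))

-- Tableaux as Boolean-valued functions

Filling : ℕ → Set
Filling n = ℕ → ℕ → Fin n → Bool

-- Comparing all pairs of elements replaces comparing a maximum with a minimum, and so needs no
-- proof of non-emptiness. The parameter is `_≤_` along rows and `_<_` down columns.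
Before : Rel ℕ _ → (s t : Fin n → Bool) → Set
Before _∼_ s t = ∀ x y → s x ≡ true → t y ≡ true → toℕ x ∼ toℕ y

before? : ∀ {_∼_ : Rel ℕ _} → Decidable₂ _∼_ → (s t : Fin n → Bool) → Dec (Before _∼_ s t)
before? _∼?_ s t = Fin.all? λ x → Fin.all? λ y →
  (s x Bool.≟ true) →-dec ((t y Bool.≟ true) →-dec (toℕ x ∼? toℕ y))

∈-tabulate⁺ : ∀ {s : Fin n → Bool} {x} → s x ≡ true → x ∈ Vec.tabulate s
∈-tabulate⁺ {s = s} {x} x∈s = Vec.lookup⇒[]= x _ (trans (Vec.lookup∘tabulate s x) x∈s)

∈-tabulate⁻ : ∀ (s : Fin n → Bool) {x} → x ∈ Vec.tabulate s → s x ≡ true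
∈-tabulate⁻ s {x} x∈s = trans (sym (Vec.lookup∘tabulate s x)) (Vec.[]=⇒lookup x∈s)

module _ (θ : SkewDiagram) where

  infix 4 _≐_
  -- A `Filling` is total so that no membership proofs are carried; its values outside θ are
  -- arbitrary and not compared.
  _≐_ : Rel (Filling n) _
  f ≐ g = ∀ i j → InSkew θ i j → ∀ x → f i j x ≡ g i j x

  ≐-sym : {f g : Filling n} → f ≐ g → g ≐ f
  ≐-sym f≐g i j b x = sym (f≐g i j b x)

  ≐-trans : {f g h : Filling n} → f ≐ g → g ≐ h → f ≐ h
  ≐-trans f≐g g≐h i j b x = trans (f≐g i j b x) (g≐h i j b x)

  _≐?_ : Decidable₂ (_≐_ {n})
  f ≐? g = allBoxes? θ λ i j → Fin.all? λ x → f i j x Bool.≟ g i j x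

  IsTableau : Filling n → Set
  IsTableau f = ∀ i j → InSkew θ i j →
    (∃[ x ] f i j x ≡ true) ×
    (InSkew θ i (suc j) → Before _≤_ (f i j) (f i (suc j))) ×
    (InSkew θ (suc i) j → Before _<_ (f i j) (f (suc i) j))

  isTableau? : (f : Filling n) → Dec (IsTableau f)
  isTableau? f = allBoxes? θ λ i j →
    Fin.any? (λ x → f i j x Bool.≟ true) ×-dec
    (inSkew? θ i (suc j) →-dec before? ℕ._≤?_ _ _) ×-dec
    (inSkew? θ (suc i) j →-dec before? ℕ._<?_ _ _)

  isTableau-resp : {f g : Filling n} → f ≐ g → IsTableau f → IsTableau g
  isTableau-resp f≐g v i j b =
    let (x , x∈) , row , column = v i j b
    in (x , trans (sym (f≐g i j b x)) x∈)
     , (λ b′ x y x∈ y∈ → row b′ x y (trans (f≐g _ _ b x) x∈) (trans (f≐g _ _ b′ y) y∈))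
     , (λ b′ x y x∈ y∈ → column b′ x y (trans (f≐g _ _ b x) x∈) (trans (f≐g _ _ b′ y) y∈))

  -- The decision is an argument so that later proofs can match on it directly.
  entryAt : SVT θ n → ∀ i j → Dec (InSkew θ i j) → Fin n → Bool
  entryAt T i j (yes b) x = Vec.lookup (entry T i j b) x
  entryAt T i j (no _)  x = false

  toFilling : SVT θ n → Filling n
  toFilling T i j = entryAt T i j (inSkew? θ i j)

  toFilling-entry : (T : SVT θ n) → ∀ {i j} .(b : InSkew θ i j) x →
    toFilling T i j x ≡ Vec.lookup (entry T i j b) x
  toFilling-entry T {i} {j} b x = lemma (inSkew? θ i j)
    where
    lemma : ∀ b? → entryAt T i j b? x ≡ Vec.lookup (entry T i j b) x
    lemma (yes _) = refl
    lemma (no ¬b) = ⊥-elim-irr (¬b b)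

  toFilling-∈ : (T : SVT θ n) → ∀ {i j} (b : InSkew θ i j) {x} →
    toFilling T i j x ≡ true → x ∈ entry T i j b
  toFilling-∈ T b {x} x∈ = Vec.lookup⇒[]= x _ (trans (sym (toFilling-entry T b x)) x∈)

  toFilling-isTableau : (T : SVT θ n) → IsTableau (toFilling T)
  toFilling-isTableau T i j b =
      (let x , x∈ = nonempty T i j b in x , trans (toFilling-entry T b x) (Vec.[]=⇒lookup x∈))
    , (λ b′ x y x∈ y∈ → ℕ.≤-trans (maximum-≥ _ _ (toFilling-∈ T b x∈))
        (ℕ.≤-trans (row-weak T i j b b′) (minimum-≤ _ _ (toFilling-∈ T b′ y∈))))
    , (λ b′ x y x∈ y∈ → ℕ.≤-<-trans (maximum-≥ _ _ (toFilling-∈ T b x∈))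
        (ℕ.<-≤-trans (column-strict T i j b b′) (minimum-≤ _ _ (toFilling-∈ T b′ y∈))))

  fromFilling : (f : Filling n) → IsTableau f → SVT θ n
  fromFilling {n} f v = record
    { entry         = λ i j _ → Vec.tabulate (f i j)
    ; nonempty      = λ i j b → let x , x∈ = proj₁ (valid b) in x , ∈-tabulate⁺ x∈
    ; row-weak      = λ i j b b′ → proj₁ (proj₂ (valid b)) (recompute (inSkew? θ _ _) b′) _ _
                        (∈-tabulate⁻ (f i j) (maximum-∈ _ _)) (∈-tabulate⁻ (f i (suc j)) (minimum-∈ _ _))
    ; column-strict = λ i j b b′ → proj₂ (proj₂ (valid b)) (recompute (inSkew? θ _ _) b′) _ _
                        (∈-tabulate⁻ (f i j) (maximum-∈ _ _)) (∈-tabulate⁻ (f (suc i) j) (minimum-∈ _ _))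
    }
    where
    -- The box proof is irrelevant here; a usable one is recomputed from `inSkew?`.
    valid : ∀ {i j} → .(InSkew θ i j) → _
    valid {i} {j} b = v i j (recompute (inSkew? θ i j) b)

  toFilling-fromFilling : (f : Filling n) (v : IsTableau f) → toFilling (fromFilling f v) ≐ f
  toFilling-fromFilling f v i j b x =
    trans (toFilling-entry (fromFilling f v) b x) (Vec.lookup∘tabulate (f i j) x)

  module _ {n : ℕ} where
    open Setoid (SVT-setoid θ n) using (_≈_; isEquivalence) public

    toFilling-cong : ∀ S T → S ≈ T → toFilling S ≐ toFilling T
    toFilling-cong S T S≈T i j b x = trans (toFilling-entry S b x)
      (trans (cong (λ p → Vec.lookup p x) (S≈T i j b)) (sym (toFilling-entry T b x)))

    toFilling-injective : ∀ S T → toFilling S ≐ toFilling T → S ≈ T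
    toFilling-injective S T S≐T i j b = begin
      entry S i j b                                ≡⟨ Vec.tabulate∘lookup _ ⟨
      Vec.tabulate (Vec.lookup (entry S i j b))    ≡⟨ Vec.tabulate-cong pointwise ⟩
      Vec.tabulate (Vec.lookup (entry T i j b))    ≡⟨ Vec.tabulate∘lookup _ ⟩
      entry T i j b                                ∎
      where
      open ≡-Reasoning
      pointwise : ∀ x → Vec.lookup (entry S i j b) x ≡ Vec.lookup (entry T i j b) x
      pointwise x = trans (sym (toFilling-entry S b x))
        (trans (S≐T i j (recompute (inSkew? θ i j) b) x) (toFilling-entry T b x))

    SVT-decSetoid : DecSetoid _ _
    SVT-decSetoid = record
      { isDecEquivalence = record
        { isEquivalence = isEquivalence
        ; _≟_           = λ S T → map′ (toFilling-injective S T) (toFilling-cong S T)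
                                   (toFilling S ≐? toFilling T)
        }
      }

  -- Finiteness of the set of tableaux.

  private
    rows columns : ℕ
    rows    = bound (outer θ)
    columns = part (outer θ) 0

  -- An array of `suc rows` by `suc columns` cells with `n` bits each, packed into one number; `suc`
  -- keeps the moduli in `decode` non-zero.
  Code : ℕ → Set
  Code n = Fin (((2 ^ n) ^ suc columns) ^ suc rows)

  -- No box of θ has its indices wrapped by _mod_; outside θ the values are junk.
  decode : Code n → Filling n
  decode c i j x =
    Inverse.to Fin.2↔Bool (finToFun (finToFun (finToFun c (i mod suc rows)) (j mod suc columns)) x)

  bits : Filling n → Fin (suc rows) → Fin (suc columns) → Fin n → Fin 2
  bits f i j x = Inverse.from Fin.2↔Bool (f (toℕ i) (toℕ j) x)

  encode : Filling n → Code n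
  encode f = funToFin λ i → funToFin λ j → funToFin (bits f i j)

  toℕ-mod : ∀ {k m} → k < m → toℕ (k mod suc m) ≡ k
  toℕ-mod k<m = trans (Fin.toℕ-fromℕ< _) (m<n⇒m%n≡m (ℕ.m<n⇒m<1+n k<m))

  decode-encode : (f : Filling n) → decode (encode f) ≐ f
  decode-encode {n} f i j b x = begin
    toBool (finToFun (finToFun (finToFun (encode f) i′) j′) x)
      ≡⟨ cong (λ c → toBool (finToFun (finToFun c j′) x))
           (Fin.finToFun-funToFin (λ i → funToFin λ j → funToFin (bits f i j)) i′) ⟩
    toBool (finToFun (finToFun (funToFin (λ j → funToFin (bits f i′ j))) j′) x)
      ≡⟨ cong (λ c → toBool (finToFun c x))
           (Fin.finToFun-funToFin (λ j → funToFin (bits f i′ j)) j′) ⟩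
    toBool (finToFun (funToFin (bits f i′ j′)) x)
      ≡⟨ cong toBool (Fin.finToFun-funToFin (bits f i′ j′) x) ⟩
    toBool (bits f i′ j′ x)
      ≡⟨ Inverse.strictlyInverseˡ Fin.2↔Bool _ ⟩
    f (toℕ i′) (toℕ j′) x
      ≡⟨ cong₂ (λ i j → f i j x) (toℕ-mod (row<bound θ b)) (toℕ-mod (column<width θ b)) ⟩
    f i j x ∎
    where
    open ≡-Reasoning
    toBool : Fin 2 → Bool
    toBool = Inverse.to Fin.2↔Bool
    i′ : Fin (suc rows)
    i′ = i mod suc rows
    j′ : Fin (suc columns)
    j′ = j mod suc columns

  -- `T₀` is the default value at codes that do not decode to a tableau.
  SVT-cardinality : SVT θ n → ∃[ N ] HasCardinality (SVT-setoid θ n) N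
  SVT-cardinality {n} T₀ = finite⇒cardinality SVT-decSetoid decodeSVT surjective
    where
    fromDec : {f : Filling n} → Dec (IsTableau f) → SVT θ n
    fromDec {f} (yes v) = fromFilling f v
    fromDec     (no _)  = T₀

    decodeSVT : Code n → SVT θ n
    decodeSVT c = fromDec (isTableau? (decode c))

    surjective : ∀ T → ∃[ c ] decodeSVT c ≈ T
    surjective T = c , lemma (isTableau? (decode c))
      where
      c = encode (toFilling T)
      lemma : (v? : Dec (IsTableau (decode c))) → fromDec v? ≈ T
      lemma (yes v) = toFilling-injective _ T
        (≐-trans (toFilling-fromFilling _ v) (decode-encode (toFilling T)))
      lemma (no ¬v) = contradiction
        (isTableau-resp (≐-sym (decode-encode (toFilling T))) (toFilling-isTableau T)) ¬v

  -- Off boxes and pivots.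

  Off : Filling n → ℕ → ℕ → Set
  Off f i j = InSkew θ i j × ∃[ x ] f i j x ≡ true × toℕ x ≢ depth θ i j

  off? : (f : Filling n) → ∀ i j → Dec (Off f i j)
  off? f i j = inSkew? θ i j ×-dec
    Fin.any? λ x → (f i j x Bool.≟ true) ×-dec ¬? (toℕ x ℕ.≟ depth θ i j)

  -- `⊥` covers the border of the quadrant; a neighbour outside θ is not off because `Off` includes
  -- membership.
  OffLeft OffAbove : Filling n → ℕ → ℕ → Set
  OffLeft f i zero    = ⊥
  OffLeft f i (suc j) = Off f i j
  OffAbove f zero    j = ⊥
  OffAbove f (suc i) j = Off f i j

  offLeft? : (f : Filling n) → ∀ i j → Dec (OffLeft f i j)
  offLeft? f i zero    = no λ ()
  offLeft? f i (suc j) = off? f i j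

  offAbove? : (f : Filling n) → ∀ i j → Dec (OffAbove f i j)
  offAbove? f zero    j = no λ ()
  offAbove? f (suc i) j = off? f i j

  Pivot : Filling n → ℕ → ℕ → Set
  Pivot f i j = Off f i j × ¬ OffLeft f i j × ¬ OffAbove f i j

  pivot? : (f : Filling n) → ∀ i j → Dec (Pivot f i j)
  pivot? f i j = off? f i j ×-dec ¬? (offLeft? f i j) ×-dec ¬? (offAbove? f i j)

  -- `Pivot` depends on the filling only through its set of off boxes.
  pivot-resp : {f g : Filling n} → (∀ {i j} → Off f i j ⇔ Off g i j) →
    ∀ {i j} → Pivot f i j → Pivot g i j
  pivot-resp {f = f} {g} f⇔g {i} {j} (off , ¬left , ¬above) =
    Equivalence.to f⇔g off , ¬left ∘ left j , ¬above ∘ above i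
    where
    left : ∀ j → OffLeft g i j → OffLeft f i j
    left (suc j) = Equivalence.from f⇔g
    above : ∀ i → OffAbove g i j → OffAbove f i j
    above (suc i) = Equivalence.from f⇔g

  -- An off box that is no pivot has an off neighbour to its left or above; moving there repeatedly
  -- must end at a pivot.
  no-pivot⇒no-off : (f : Filling n) → (∀ i j → ¬ Pivot f i j) → ∀ i j → ¬ Off f i j
  no-pivot⇒no-off f ¬pivot i j off = ¬pivot i j (off , ¬left i j , ¬above i j)
    where
    ¬left : ∀ i j → ¬ OffLeft f i j
    ¬left i (suc j) = no-pivot⇒no-off f ¬pivot i j
    ¬above : ∀ i j → ¬ OffAbove f i j
    ¬above (suc i) j = no-pivot⇒no-off f ¬pivot i j

  off-resp : {f g : Filling n} → f ≐ g → ∀ {i j} → Off f i j → Off g i j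
  off-resp f≐g (b , x , x∈ , x≢) = b , x , trans (sym (f≐g _ _ b x)) x∈ , x≢

  -- The toggling involution on fillings.

  Flip : Filling n → ℕ → ℕ → Fin n → Set
  Flip f i j x = Pivot f i j × toℕ x ≡ depth θ i j

  flip? : (f : Filling n) → ∀ i j x → Dec (Flip f i j x)
  flip? f i j x = pivot? f i j ×-dec (toℕ x ℕ.≟ depth θ i j)

  toggle : Filling n → Filling n
  toggle f i j x = f i j x xor does (flip? f i j x)

  toggle-unflipped : (f : Filling n) → ∀ {i j x} → ¬ Flip f i j x → toggle f i j x ≡ f i j x
  toggle-unflipped f {i} {j} {x} ¬flip
    rewrite dec-false (flip? f i j x) ¬flip = Bool.xor-identityʳ _

  toggle-flipped : (f : Filling n) → ∀ {i j x} → Flip f i j x → toggle f i j x ≢ f i j x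
  toggle-flipped f {i} {j} {x} flip
    rewrite dec-true (flip? f i j x) flip | Bool.xor-comm (f i j x) true = Bool.not-¬ refl ∘ sym

  toggle-∈ : (f : Filling n) → ∀ {i j x} → toggle f i j x ≡ true → Flip f i j x ⊎ f i j x ≡ true
  toggle-∈ f {i} {j} {x} x∈ with flip? f i j x
  ... | yes flip = inj₁ flip
  ... | no ¬flip = inj₂ (trans (sym (toggle-unflipped f ¬flip)) x∈)

  -- A witness of being off differs from the depth, and only the depth is ever flipped.
  toggle-off : (f : Filling n) → ∀ {i j} → Off f i j ⇔ Off (toggle f) i j
  toggle-off f = mk⇔
    (λ { (b , x , x∈ , x≢) → b , x , trans (toggle-unflipped f (x≢ ∘ proj₂)) x∈ , x≢ })
    (λ { (b , x , x∈ , x≢) → b , x , trans (sym (toggle-unflipped f (x≢ ∘ proj₂))) x∈ , x≢ })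

  does-flip?-resp : {f g : Filling n} → (∀ {i j} → Off f i j ⇔ Off g i j) →
    ∀ i j x → does (flip? f i j x) ≡ does (flip? g i j x)
  does-flip?-resp {f = f} {g} f⇔g i j x = does-⇔
    (mk⇔ (λ { (p , eq) → pivot-resp f⇔g p , eq })
         (λ { (p , eq) → pivot-resp (mk⇔ (Equivalence.from f⇔g) (Equivalence.to f⇔g)) p , eq }))
    (flip? f i j x) (flip? g i j x)

  toggle-cong : {f g : Filling n} → f ≐ g → toggle f ≐ toggle g
  toggle-cong f≐g i j b x = cong₂ _xor_ (f≐g i j b x)
    (does-flip?-resp (mk⇔ (off-resp f≐g) (off-resp (≐-sym f≐g))) i j x)

  -- By `toggle-off` both rounds flip at the same places, and a double `xor` cancels.
  toggle-involutive : (f : Filling n) → toggle (toggle f) ≐ f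
  toggle-involutive f i j b x = begin
    (f i j x xor does (flip? f i j x)) xor does (flip? (toggle f) i j x)
      ≡⟨ cong (toggle f i j x xor_) (does-flip?-resp (toggle-off f) i j x) ⟨
    (f i j x xor does (flip? f i j x)) xor does (flip? f i j x)
      ≡⟨ Bool.xor-assoc (f i j x) _ _ ⟩
    f i j x xor (does (flip? f i j x) xor does (flip? f i j x))
      ≡⟨ cong (f i j x xor_) (Bool.xor-same (does (flip? f i j x))) ⟩
    f i j x xor false
      ≡⟨ Bool.xor-identityʳ _ ⟩
    f i j x ∎
    where open ≡-Reasoning

  -- Toggling preserves the tableau conditions.

  depth-≤-entry : {f : Filling n} → IsTableau f →
    ∀ i j → InSkew θ i j → ∀ {x} → f i j x ≡ true → depth θ i j ≤ toℕ x
  depth-≤-entry v zero    j b x∈ = z≤n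
  depth-≤-entry v (suc i) j b {x} x∈ with inSkew? θ i j
  ... | no ¬a rewrite depth-suc-outside θ ¬a = z≤n
  ... | yes a rewrite depth-suc θ a =
    let (y , y∈) , _ , column = v i j a
    in ℕ.≤-<-trans (depth-≤-entry v i j a y∈) (column b y x y∈ x∈)

  depth-≤-toggled : {f : Filling n} → IsTableau f →
    ∀ {i j} → InSkew θ i j → ∀ {x} → toggle f i j x ≡ true → depth θ i j ≤ toℕ x
  depth-≤-toggled {f = f} v b x∈ with toggle-∈ f x∈
  ... | inj₁ (_ , x≡) = ℕ.≤-reflexive (sym x≡)
  ... | inj₂ x∈       = depth-≤-entry v _ _ b x∈

  ¬off⇒≡depth : (f : Filling n) → ∀ {i j} → InSkew θ i j → ¬ Off f i j →
    ∀ {x} → f i j x ≡ true → toℕ x ≡ depth θ i j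
  ¬off⇒≡depth f {i} {j} b ¬off {x} x∈ with toℕ x ℕ.≟ depth θ i j
  ... | yes x≡ = x≡
  ... | no  x≢ = contradiction (b , x , x∈ , x≢) ¬off

  -- Treats rows and columns at once: only compatibility of `_∼_` with `_≤_` is used, and that the
  -- first box is not off when the second is a pivot.
  toggle-before : ∀ {_∼_ : Rel ℕ _} →
    (∀ {k l m} → k ≤ l → l ∼ m → k ∼ m) → (∀ {k l m} → k ∼ l → l ≤ m → k ∼ m) →
    {f : Filling n} → IsTableau f → ∀ {i j i′ j′} → InSkew θ i j → InSkew θ i′ j′ →
    (Pivot f i′ j′ → ¬ Off f i j) → depth θ i j ∼ depth θ i′ j′ →
    Before _∼_ (f i j) (f i′ j′) → Before _∼_ (toggle f i j) (toggle f i′ j′)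
  toggle-before {_∼_ = _∼_} ≤-∼-trans ∼-≤-trans {f} v {i} {j} {i′} {j′} b b′
    pivot⇒¬off depth∼depth′ before x y x∈ y∈
    with pivot? f i′ j′
  -- The first box is not off, also after toggling, so `x` is its depth, while `y` is at least the
  -- depth of the second box.
  ... | yes p = ≤-∼-trans
    (ℕ.≤-reflexive (¬off⇒≡depth (toggle f) b (pivot⇒¬off p ∘ Equivalence.from (toggle-off f)) x∈))
    (∼-≤-trans depth∼depth′ (depth-≤-toggled v b′ y∈))
  ... | no ¬p with toggle-∈ f y∈ | toggle-∈ f x∈
  ...   | inj₁ (p , _) | _        = contradiction p ¬p
  ...   | inj₂ y∈f     | inj₂ x∈f = before x y x∈f y∈f
  -- Here `x` is the newly added depth; the witness `z` that the box is off was already present,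
  -- with `x` at most `z` and `z ∼ y`.
  ...   | inj₂ y∈f     | inj₁ (((_ , z , z∈f , _) , _) , x≡) =
    ≤-∼-trans (subst (_≤ toℕ z) (sym x≡) (depth-≤-entry v i j b z∈f)) (before z y z∈f y∈f)

  toggle-isTableau : {f : Filling n} → IsTableau f → IsTableau (toggle f)
  toggle-isTableau {f = f} v i j b = inhabited
    -- At `(i , suc j)` the clause `OffLeft`, and at `(suc i , j)` the clause `OffAbove`, unfolds to
    -- `Off` at `(i , j)`.
    , (λ b′ → toggle-before ℕ.≤-trans ℕ.≤-trans v b b′ (λ p → proj₁ (proj₂ p))
                (depth-mono θ i j b′) (row b′))
    , (λ b′ → toggle-before ℕ.≤-<-trans ℕ.<-≤-trans v b b′ (λ p → proj₂ (proj₂ p))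
                (ℕ.≤-reflexive (sym (depth-suc θ b))) (column b′))
    where
    row    = proj₁ (proj₂ (v i j b))
    column = proj₂ (proj₂ (v i j b))
    inhabited : ∃[ x ] toggle f i j x ≡ true
    inhabited with pivot? f i j
    -- At a pivot the witness of being off is not the depth, so it survives.
    ... | yes ((_ , x , x∈ , x≢) , _) = x , trans (toggle-unflipped f (x≢ ∘ proj₂)) x∈
    ... | no ¬p = let x , x∈ = proj₁ (v i j b) in x , trans (toggle-unflipped f (¬p ∘ proj₁)) x∈

  -- The filling by depths as the only fixed point.

  depthFilling : Filling n
  depthFilling i j x = does (toℕ x ℕ.≟ depth θ i j)

  ∈-depthFilling⁺ : ∀ i j {x : Fin n} → toℕ x ≡ depth θ i j → depthFilling i j x ≡ true
  ∈-depthFilling⁺ _ _ = dec-true (_ ℕ.≟ _)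

  ∈-depthFilling⁻ : ∀ i j {x : Fin n} → depthFilling i j x ≡ true → toℕ x ≡ depth θ i j
  ∈-depthFilling⁻ i j {x} x∈ with toℕ x ℕ.≟ depth θ i j
  ... | yes x≡ = x≡
  ... | no  x≢ = contradiction (trans (sym (dec-false (toℕ x ℕ.≟ depth θ i j) x≢)) x∈) λ ()

  toggle-depthFilling : toggle depthFilling ≐ depthFilling {n}
  toggle-depthFilling i j b x = toggle-unflipped depthFilling {i} {j} {x}
    λ { (((_ , _ , y∈ , y≢) , _) , _) → y≢ (∈-depthFilling⁻ i j y∈) }

  no-off⇒depthFilling : {f : Filling n} → IsTableau f → (∀ i j → ¬ Off f i j) → f ≐ depthFilling
  no-off⇒depthFilling {f = f} v ¬off i j b x with toℕ x ℕ.≟ depth θ i j | f i j x in eq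
  ... | no x≢  | true  = contradiction (b , x , eq , x≢) (¬off i j)
  ... | no x≢  | false = sym (dec-false (toℕ x ℕ.≟ depth θ i j) x≢)
  ... | yes x≡ | true  = sym (dec-true (toℕ x ℕ.≟ depth θ i j) x≡)
  -- Non-emptiness gives some `y`; the box not being off forces it to be the depth, hence `x`.
  ... | yes x≡ | false =
    let y , y∈ = proj₁ (v i j b)
        y≡x = Fin.toℕ-injective (trans (¬off⇒≡depth f b (¬off i j) y∈) (sym x≡))
    in contradiction (trans (sym eq) (subst (λ z → f i j z ≡ true) y≡x y∈)) λ ()

  module _ (depth<n : ∀ {i j} → InSkew θ i j → depth θ i j < n) where

    depthFilling-isTableau : IsTableau (depthFilling {n})
    depthFilling-isTableau i j b =
        (fromℕ< (depth<n b) , ∈-depthFilling⁺ i j (Fin.toℕ-fromℕ< (depth<n b)))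
      , (λ b′ x y x∈ y∈ → subst₂ _≤_ (sym (∈-depthFilling⁻ i j x∈)) (sym (∈-depthFilling⁻ i (suc j) y∈))
          (depth-mono θ i j b′))
      , (λ b′ x y x∈ y∈ → subst₂ _<_ (sym (∈-depthFilling⁻ i j x∈)) (sym (∈-depthFilling⁻ (suc i) j y∈))
          (ℕ.≤-reflexive (sym (depth-suc θ b))))

    -- At a pivot, `depth<n` supplies the element of `Fin n` where `toggle f` and `f` differ; so a
    -- fixed filling has no pivot and hence no off box.
    toggle-fixed⇒depthFilling : {f : Filling n} → IsTableau f → toggle f ≐ f → f ≐ depthFilling
    toggle-fixed⇒depthFilling {f} v fixed = no-off⇒depthFilling v (no-pivot⇒no-off f ¬pivot)
      where
      ¬pivot : ∀ i j → ¬ Pivot f i j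
      ¬pivot i j p@((b , _) , _) =
        toggle-flipped f (p , Fin.toℕ-fromℕ< (depth<n b)) (fixed i j b _)

    -- The involution on tableaux and the parity of their number.

    depthSVT : SVT θ n
    depthSVT = fromFilling depthFilling depthFilling-isTableau

    toggleSVT : SVT θ n → SVT θ n
    toggleSVT T = fromFilling (toggle (toFilling T)) (toggle-isTableau (toFilling-isTableau T))

    toFilling-toggleSVT : ∀ T → toFilling (toggleSVT T) ≐ toggle (toFilling T)
    toFilling-toggleSVT T =
      toFilling-fromFilling (toggle (toFilling T)) (toggle-isTableau (toFilling-isTableau T))

    toFilling-depthSVT : toFilling depthSVT ≐ depthFilling
    toFilling-depthSVT = toFilling-fromFilling depthFilling depthFilling-isTableau

    -- Each requirement on the involution is checked for fillings and carried back by
    -- `toFilling-injective`.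
    SVT-odd : HasCardinality (SVT-setoid θ n) N → 2 ∤ N
    SVT-odd = involution⇒odd-cardinality (SVT-setoid θ n) toggleSVT
      (λ {S} {T} S≈T → toFilling-injective (toggleSVT S) (toggleSVT T)
        (≐-trans (toFilling-toggleSVT S)
          (≐-trans (toggle-cong (toFilling-cong S T S≈T)) (≐-sym (toFilling-toggleSVT T)))))
      (λ T → toFilling-injective (toggleSVT (toggleSVT T)) T
        (≐-trans (toFilling-toggleSVT (toggleSVT T))
          (≐-trans (toggle-cong (toFilling-toggleSVT T)) (toggle-involutive (toFilling T)))))
      depthSVT
      (toFilling-injective (toggleSVT depthSVT) depthSVT
        (≐-trans (toFilling-toggleSVT depthSVT)
          (≐-trans (toggle-cong toFilling-depthSVT)
            (≐-trans toggle-depthFilling (≐-sym toFilling-depthSVT)))))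
      (λ T fixed → toFilling-injective T depthSVT
        (≐-trans
          (toggle-fixed⇒depthFilling (toFilling-isTableau T)
            (≐-trans (≐-sym (toFilling-toggleSVT T)) (toFilling-cong (toggleSVT T) T fixed)))
          (≐-sym toFilling-depthSVT)))

theorem3p1 : (n : ℕ) .{{_ : NonZero n}} (θ : SkewDiagram) →
    (∀ j → columnSize θ j ≤ n) →
    ∃[ N ] (HasCardinality (SVT-setoid θ n) N × 2 ∤ N)
theorem3p1 n θ columns≤n =
  -- The filling by depths also serves as the default tableau for the enumeration.
  let N , cardinality = SVT-cardinality θ (depthSVT θ depth<n)
  in N , cardinality , SVT-odd θ depth<n cardinality
  where
  depth<n : ∀ {i j} → InSkew θ i j → depth θ i j < n
  depth<n {j = j} b = ℕ.<-≤-trans (depth<columnSize θ b) (columns≤n j)
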